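{- Let $p$ be an odd prime and let $c$ be an integer such that $-c-1$ is a quadratic nonresidue modulo $p$. For every integer $n \ge 1$ define $$q_n = \left\lfloor \frac{(p-1)!\,(n^2 + c)}{p} \right\rfloor.$$ Then for all $n \ge 1$, $q_n$ has a prime factor smaller than $p$, and therefore $q_n$ is composite.
   Formalization: The claim that q_n is composite fails when q_n = 0 or when p = 3 and |q_n| = 2 (e.g. p = 3, c = 0 gives q_1 = 0, q_2 = 2); compositeness is stated for |q_n| with exactly these values excluded. -}

module Defs where

open import Data.Nat.Base as ℕ using (ℕ; NonZero; _∸_; _!)
open import Data.Integer.Base using (ℤ; +_; _+_; _*_; _-_)
open import Data.Integer.Divisibility using (_∣_)
open import Data.Rational.Base using (_/_; floor)
open import Data.Product.Base using (∃-syntax)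
open import Relation.Nullary.Negation.Core using (¬_)

QuadraticResidue : ℕ → ℤ → Set
QuadraticResidue p a = ∃[ x ] (+ p) ∣ (x * x - a)

-- 0 is a residue, so a nonresidue modulo a prime is automatically a unit.
QuadraticNonresidue : ℕ → ℤ → Set
QuadraticNonresidue p a = ¬ QuadraticResidue p a

-- The floor of a rational number (rounding towards -∞); the value may be
-- zero or negative, since c is an arbitrary integer.
q : (p : ℕ) → .{{NonZero p}} → ℤ → ℕ → ℤ
q p c n = floor ((+ ((p ∸ 1) !) * (+ (n ℕ.* n) + c)) / p)

{-# OPTIONS --safe #-}
module Submission where

-- Write (p-1)! (n² + c) = q p + r with 0 ≤ r < p.  By Wilson's theorem
-- r ≡ -(n² + c) modulo p, so r = 1 would make -c-1 ≡ n² a quadratic residue.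
-- Hence r = 0 or r ≥ 2, and some prime s < p divides r.  As s also divides
-- (p-1)!, it divides q p, and therefore q.  Finally |q| = s is impossible for
-- p ≥ 5 and q ≠ 0, because then |q p + r| ≥ (p-1)! > s p + r.

open import Defs
open import Data.Nat.Base using (ℕ; _≤_; _<_)
open import Data.Nat.Divisibility using () renaming (_∣_ to _∣ℕ_)
open import Data.Nat.Primality using (Prime; Composite; prime⇒nonZero)
open import Data.Integer.Base using (ℤ; +_; -_; _-_; ∣_∣; 0ℤ; 1ℤ)
open import Data.Integer.Divisibility using (_∣_)
open import Data.Product.Base using (_×_; ∃-syntax)
open import Relation.Nullary.Negation.Core using (¬_)
open import Relation.Binary.PropositionalEquality.Core using (_≡_; _≢_)

import Data.Integer.Base as ℤ
import Data.Integer.Divisibility.Signed as Signed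
import Data.Integer.DivMod as ℤ
import Data.Integer.GCD as ℤ
import Data.Integer.Properties as ℤ
import Data.Integer.Tactic.RingSolver as ℤ
import Data.Rational.Base as ℚ
import Data.Rational.Properties as ℚ
open import Data.List.Base using (List; []; _∷_; _++_; length; applyDownFrom)
open import Data.List.Membership.Propositional using (_∈_)
open import Data.List.Membership.Propositional.Properties using (∈-∃++; ∈-applyDownFrom⁺; ∈-applyDownFrom⁻)
open import Data.List.Relation.Binary.Permutation.Propositional using (↭-sym; ↭-prep; ↭⇒↭ₛ)
open import Data.List.Relation.Binary.Permutation.Propositional.Properties using (All-resp-↭; ∈-resp-↭; shift; ↭-length)
import Data.List.Relation.Binary.Permutation.Setoid.Properties as Permutationₛ
open import Data.List.Relation.Unary.All as All using (All; []; _∷_)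
open import Data.List.Relation.Unary.AllPairs using (_∷_)
open import Data.List.Relation.Unary.Any using (here; there)
open import Data.List.Relation.Unary.Unique.Propositional using (Unique)
open import Data.List.Relation.Unary.Unique.Propositional.Properties using (applyDownFrom⁺₁)
open import Data.Nat.Base as ℕ hiding (∣_-_∣)
open import Data.Nat.Coprimality using (coprime-Bézout; prime⇒coprime)
open import Data.Nat.Divisibility hiding (_∣_)
open import Data.Nat.DivMod
open import Data.Nat.GCD using (module Bézout)
open import Data.Nat.ListAction using (product)
open import Data.Nat.ListAction.Properties using (product-↭)
open import Data.Nat.Primality
open import Data.Nat.Primality.Factorisation using (factorise)
open import Data.Nat.Properties
open import Data.Nat.Tactic.RingSolver using (solve-∀)
open import Data.Product.Base using (_,_)
open import Data.Sum.Base using (_⊎_; inj₁; inj₂)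
open import Function.Base using (_∘_; it)
open import Relation.Binary.PropositionalEquality
open import Relation.Nullary.Decidable.Core using (yes; no)
open import Relation.Nullary.Negation.Core using (contradiction)

-- Inverses modulo `p` and products that cancel in pairs.

module _ (p : ℕ) .{{_ : NonZero p}} where

  infix 4 _InverseOf_
  _InverseOf_ : ℕ → ℕ → Set
  y InverseOf x = x * y % p ≡ 1

  inverse-sym : ∀ {x y} → y InverseOf x → x InverseOf y
  inverse-sym {x} {y} xy≡1 = trans (cong (_% p) (*-comm y x)) xy≡1

  *-absorb-1ˡ : ∀ a b → a % p ≡ 1 → a * b % p ≡ b % p
  *-absorb-1ˡ a b a≡1 = begin
    a * b % p             ≡⟨ %-distribˡ-* a b p ⟩
    (a % p) * (b % p) % p ≡⟨ cong (λ u → u * (b % p) % p) a≡1 ⟩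
    1 * (b % p) % p       ≡⟨ cong (_% p) (*-identityˡ (b % p)) ⟩
    b % p % p             ≡⟨ m%n%n≡m%n b p ⟩
    b % p                 ∎
    where open ≡-Reasoning

  -- The product `x * y * z` reduces to `z` by cancelling `x * y` and to `y` by cancelling `z * x`;
  -- the bounds turn the congruence into an equality.
  inverse-unique : ∀ {x y z} → y < p → z < p →
                   y InverseOf x → x InverseOf z → z ≡ y
  inverse-unique {x} {y} {z} y<p z<p xy≡1 zx≡1 = begin
    z               ≡⟨ m<n⇒m%n≡m z<p ⟨
    z % p           ≡⟨ *-absorb-1ˡ (x * y) z xy≡1 ⟨
    x * y * z % p   ≡⟨ cong (_% p) (rearrange x y z) ⟩
    z * x * y % p   ≡⟨ *-absorb-1ˡ (z * x) y zx≡1 ⟩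
    y % p           ≡⟨ m<n⇒m%n≡m y<p ⟩
    y               ∎
    where
    open ≡-Reasoning
    rearrange : ∀ x y z → x * y * z ≡ z * x * y
    rearrange = solve-∀

  Paired : List ℕ → Set
  Paired xs = ∀ {x} → x ∈ xs → ∃[ y ] y ∈ xs × y ≢ x × y InverseOf x

  -- The head and its partner multiply to 1, so both can be deleted, and what remains is again
  -- paired. The partner may sit anywhere in the tail, so the recursion runs on a bound for the
  -- length instead of on the list.
  product-paired : 1 < p → ∀ xs → Unique xs → All (_< p) xs → Paired xs →
                   product xs % p ≡ 1
  product-paired 1<p xs = go (length xs) xs ≤-refl
    where
    go : ∀ n xs → length xs ≤ n → Unique xs → All (_< p) xs → Paired xs →
         product xs % p ≡ 1
    go _ [] _ _ _ _ = m<n⇒m%n≡m 1<p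
    go (suc n) (x ∷ xs) (s≤s ∣xs∣≤n) (x∉xs ∷ xs!) (x<p ∷ xs<p) paired
      with paired (here refl)
    ... | y , here y≡x , y≢x , _ = contradiction y≡x y≢x
    ... | y , there y∈xs , _ , xy≡1
      with as , bs , refl ← ∈-∃++ y∈xs
      with y∉ys ∷ ys! ← Permutationₛ.Unique-resp-↭ (setoid ℕ) (↭⇒↭ₛ (shift y as bs)) xs!
      with _ ∷ x∉ys ← All-resp-↭ (shift y as bs) x∉xs
      with y<p ∷ ys<p ← All-resp-↭ (shift y as bs) xs<p
      = begin
        x * product xs % p         ≡⟨ cong (λ u → x * u % p) (product-↭ xs↭y∷ys) ⟩
        x * (y * product ys) % p   ≡⟨ cong (_% p) (*-assoc x y (product ys)) ⟨
        x * y * product ys % p     ≡⟨ *-absorb-1ˡ (x * y) (product ys) xy≡1 ⟩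
        product ys % p             ≡⟨ go n ys ∣ys∣≤n ys! ys<p paired′ ⟩
        1                          ∎
      where
      open ≡-Reasoning
      ys = as ++ bs
      xs↭y∷ys = shift y as bs

      ∣ys∣≤n : length ys ≤ n
      ∣ys∣≤n = ≤-trans (n≤1+n _) (subst (_≤ n) (↭-length xs↭y∷ys) ∣xs∣≤n)

      paired′ : Paired ys
      paired′ {z} z∈ys
        with w , w∈ , w≢z , zw≡1 ← paired (there (∈-resp-↭ (↭-sym xs↭y∷ys) (there z∈ys)))
        with ∈-resp-↭ (↭-prep x xs↭y∷ys) w∈
      -- The partner `w` of `z` survives the deletion: by uniqueness of inverses, `w = x` would
      -- force `z = y`, and `w = y` would force `z = x`, but neither `x` nor `y` occurs in `ys`.
      ... | here refl = contradiction
              (sym (inverse-unique y<p (All.lookup ys<p z∈ys) xy≡1 zw≡1))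
              (All.lookup y∉ys z∈ys)
      ... | there (here refl) = contradiction
              (sym (inverse-unique x<p (All.lookup ys<p z∈ys) (inverse-sym {x} xy≡1) zw≡1))
              (All.lookup x∉ys z∈ys)
      ... | there (there w∈ys) = w , w∈ys , w≢z , zw≡1

  inverse-reduce : ∀ x y → y InverseOf x → y % p InverseOf x
  inverse-reduce x y xy≡1 = begin
    x * (y % p) % p             ≡⟨ %-distribˡ-* x (y % p) p ⟩
    (x % p) * (y % p % p) % p   ≡⟨ cong (λ u → (x % p) * u % p) (m%n%n≡m%n y p) ⟩
    (x % p) * (y % p) % p       ≡⟨ %-distribˡ-* x y p ⟨
    x * y % p                   ≡⟨ xy≡1 ⟩
    1                           ∎
    where open ≡-Reasoning

-- The coefficient of `x` in Bézout's identity for the coprime pair `p`, `x` is the inverse up to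
-- sign. Over the natural numbers the identity has two variants, one for each sign.
inverse-exists : ∀ {p x} (p-prime : Prime p) .{{_ : NonZero x}} → x < p →
                 let instance _ = prime⇒nonZero p-prime in
                 ∃[ y ] y < p × _InverseOf_ p y x
inverse-exists {p} {x} p-prime x<p = reduce (inverse (coprime-Bézout (prime⇒coprime p-prime x<p)))
  where
  instance
    _ = prime⇒nonZero p-prime
  1%p≡1 : 1 % p ≡ 1
  1%p≡1 = m<n⇒m%n≡m (nonTrivial⇒n>1 p {{prime⇒nonTrivial p-prime}})

  reduce : ∃[ y ] _InverseOf_ p y x → ∃[ y ] y < p × _InverseOf_ p y x
  reduce (y , xy≡1) = y % p , m%n<n y p , inverse-reduce p x y xy≡1


  inverse : Bézout.Identity 1 p x → ∃[ y ] _InverseOf_ p y x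
  inverse (Bézout.-+ a b 1+ap≡bx) = b , (begin
    x * b % p       ≡⟨ cong (_% p) (trans (*-comm x b) (sym 1+ap≡bx)) ⟩
    (1 + a * p) % p ≡⟨ [m+kn]%n≡m%n 1 a p ⟩
    1 % p           ≡⟨ 1%p≡1 ⟩
    1               ∎)
    where open ≡-Reasoning
  -- Here b is minus the inverse of x, and p ∸ 1 stands in for -1.
  inverse (Bézout.+- a b 1+bx≡ap) = b * pred p , (begin
    x * (b * pred p) % p           ≡⟨ [m+kn]%n≡m%n (x * (b * pred p)) a p ⟨
    (x * (b * pred p) + a * p) % p ≡⟨ cong (λ u → (x * (b * pred p) + u) % p) 1+bx≡ap ⟨
    (x * (b * pred p) + (1 + b * x)) % p ≡⟨ cong (_% p) (move x b (pred p)) ⟩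
    (1 + b * x * suc (pred p)) % p ≡⟨ cong (λ u → (1 + b * x * u) % p) (suc-pred p) ⟩
    (1 + b * x * p) % p            ≡⟨ [m+kn]%n≡m%n 1 (b * x) p ⟩
    1 % p                          ≡⟨ 1%p≡1 ⟩
    1                              ∎)
    where
    open ≡-Reasoning
    move : ∀ x b k → x * (b * k) + (1 + b * x) ≡ 1 + b * x * suc k
    move = solve-∀

-- Wilson's theorem.

product-applyDownFrom-2+ : ∀ k → product (applyDownFrom (2 ℕ.+_) k) ≡ suc k !
product-applyDownFrom-2+ zero    = refl
product-applyDownFrom-2+ (suc k) = cong ((2 + k) *_) (product-applyDownFrom-2+ k)

-- For `p = 3 + k` the list runs from `p - 2` down to 2, leaving out the residues 0, 1 and -1.
-- Modulo a prime only 1 and -1 are their own inverses, and an inverse of a listed `x` is none of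
-- the three residues left out.
paired-2⋯p-2 : ∀ k → Prime (3 + k) → Paired (3 + k) (applyDownFrom (2 ℕ.+_) k)
paired-2⋯p-2 k p-prime x∈ with i , i<k , refl ← ∈-applyDownFrom⁻ (2 ℕ.+_) x∈
  = locate (inverse-exists p-prime x<p)
  where
  p = 3 + k
  x = 2 + i
  x<p : x < p
  x<p = s≤s (s≤s (m≤n⇒m≤1+n i<k))
  1+x<p : suc x < p
  1+x<p = s≤s (s≤s (s≤s i<k))

  inverse-≢ : ∀ {y} → _InverseOf_ p y x → y ≢ x
  -- Here `suc i` is `x - 1`, so the product is `x² - 1`; both factors lie strictly between 0 and
  -- `p`.
  inverse-≢ xx≡1 refl with euclidsLemma (suc i) (suc x) p-prime (divides (x * x / p) eq)
    where
    open ≡-Reasoning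
    expand : ∀ i → suc (suc i * (3 + i)) ≡ (2 + i) * (2 + i)
    expand = solve-∀
    eq : suc i * suc x ≡ x * x / p * p
    eq = suc-injective (begin
      suc (suc i * suc x)      ≡⟨ expand i ⟩
      x * x                    ≡⟨ m≡m%n+[m/n]*n (x * x) p ⟩
      x * x % p + x * x / p * p ≡⟨ cong (_+ x * x / p * p) xx≡1 ⟩
      suc (x * x / p * p)      ∎)
  ... | inj₁ p∣x-1 = >⇒∤ (<-trans (n<1+n _) x<p) p∣x-1
  ... | inj₂ p∣x+1 = >⇒∤ 1+x<p p∣x+1

  locate : ∃[ y ] y < p × _InverseOf_ p y x →
           ∃[ y ] y ∈ applyDownFrom (2 ℕ.+_) k × y ≢ x × _InverseOf_ p y x
  locate (zero , _ , x0≡1) = contradiction (trans (sym (cong (_% p) (*-zeroʳ x))) x0≡1) λ ()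
  locate (1 , _ , x1≡1) = contradiction
    (trans (sym (m<n⇒m%n≡m x<p)) (trans (cong (_% p) (sym (*-identityʳ x))) x1≡1)) λ ()
  locate (suc (suc j) , y<p , xy≡1) with m≤n⇒m<n∨m≡n (s≤s⁻¹ (s≤s⁻¹ (s≤s⁻¹ y<p)))
  ... | inj₁ j<k = 2 + j , ∈-applyDownFrom⁺ (2 ℕ.+_) j<k , inverse-≢ {2 + j} xy≡1 , xy≡1
  -- The candidate is now `p - 1`, that is -1. Adding `x` to `x * (p - 1)` gives a multiple of `p`,
  -- so remainder 1 would make `p` divide `x + 1`.
  ... | inj₂ refl = contradiction (∣m+n∣m⇒∣n p∣ (n∣m*n (x * (2 + k) / p))) (>⇒∤ 1+x<p)
    where
    open ≡-Reasoning
    p∣ : p ∣ℕ x * (2 + k) / p * p + suc x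
    p∣ = divides x (begin
      x * (2 + k) / p * p + suc x             ≡⟨ +-suc _ x ⟩
      1 + x * (2 + k) / p * p + x             ≡⟨ cong (λ u → u + x * (2 + k) / p * p + x) xy≡1 ⟨
      x * (2 + k) % p + x * (2 + k) / p * p + x ≡⟨ cong (_+ x) (m≡m%n+[m/n]*n (x * (2 + k)) p) ⟨
      x * (2 + k) + x                         ≡⟨ +-comm _ x ⟩
      x + x * (2 + k)                         ≡⟨ *-suc x (2 + k) ⟨
      x * p                                   ∎)

-- Pairing gives `(p - 2)! = 1 + j * p`; multiplying by `p - 1` and adding 1 leaves `p` plus a
-- multiple of `p`.
wilson : ∀ k → Prime (3 + k) → (3 + k) ∣ℕ suc ((2 + k) !)
wilson k p-prime = divides (1 + (2 + k) * j) (begin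
  suc ((2 + k) * suc k !)        ≡⟨ cong (λ u → suc ((2 + k) * u)) factorial ⟩
  suc ((2 + k) * (1 + j * (3 + k))) ≡⟨ collect k j ⟩
  (1 + (2 + k) * j) * (3 + k)    ∎)
  where
  open ≡-Reasoning
  p = 3 + k
  j = suc k ! / p
  collect : ∀ k j → suc ((2 + k) * (1 + j * (3 + k))) ≡ (1 + (2 + k) * j) * (3 + k)
  collect = solve-∀
  range : All (_< p) (applyDownFrom (2 ℕ.+_) k)
  range = All.tabulate λ x∈ → bound (∈-applyDownFrom⁻ (2 ℕ.+_) x∈)
    where
    bound : ∀ {x} → ∃[ i ] i < k × x ≡ 2 + i → x < p
    bound (i , i<k , refl) = s≤s (s≤s (m≤n⇒m≤1+n i<k))
  [p-2]!%p≡1 : suc k ! % p ≡ 1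
  [p-2]!%p≡1 = trans (cong (_% p) (sym (product-applyDownFrom-2+ k)))
    (product-paired p (s≤s (s≤s z≤n)) _
      (applyDownFrom⁺₁ (2 ℕ.+_) k (λ j<i _ → >⇒≢ j<i ∘ +-cancelˡ-≡ 2 _ _))
      range (paired-2⋯p-2 k p-prime))
  factorial : suc k ! ≡ 1 + j * p
  factorial = trans (m≡m%n+[m/n]*n (suc k !) p) (cong (_+ j * p) [p-2]!%p≡1)

-- The floor of a fraction as a quotient with remainder.

floor-÷ : ∀ x → ℚ.↥ x ≡ + (ℚ.↥ x ℤ.% ℚ.↧ x) ℤ.+ ℚ.floor x ℤ.* ℚ.↧ x
floor-÷ x@record{} = ℤ.a≡a%n+[a/n]*n (ℚ.↥ x) (ℚ.↧ x)

-- The rational `i / n` is stored in lowest terms, so division with remainder applies to the reduced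
-- fraction; multiplying through by the gcd `g` restores `i` and `n` and scales the remainder to
-- `r * g`.
floor-/ : ∀ i n .{{_ : NonZero n}} →
          ∃[ r ] r < n × i ≡ + r ℤ.+ ℚ.floor (i ℚ./ n) ℤ.* + n
floor-/ i n = r * g , r*g<n , (begin
  i                                              ≡⟨ ℚ.↥-/ i n ⟨
  ℚ.↥ x ℤ.* + g                                  ≡⟨ cong (ℤ._* + g) (floor-÷ x) ⟩
  (+ r ℤ.+ ℚ.floor x ℤ.* ℚ.↧ x) ℤ.* + g          ≡⟨ distribute (+ r) (ℚ.floor x) (ℚ.↧ x) (+ g) ⟩
  + r ℤ.* + g ℤ.+ ℚ.floor x ℤ.* (ℚ.↧ x ℤ.* + g)  ≡⟨ cong₂ (λ u v → u ℤ.+ ℚ.floor x ℤ.* v) (sym (ℤ.pos-* r g)) (ℚ.↧-/ i n) ⟩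
  + (r * g) ℤ.+ ℚ.floor x ℤ.* + n                ∎)
  where
  open ≡-Reasoning
  x = i ℚ./ n
  g = ∣ ℤ.gcd i (+ n) ∣
  r = ℚ.↥ x ℤ.% ℚ.↧ x

  distribute : ∀ a b c d → (a ℤ.+ b ℤ.* c) ℤ.* d ≡ a ℤ.* d ℤ.+ b ℤ.* (c ℤ.* d)
  distribute = ℤ.solve-∀

  ↧*g≡n : ℚ.↧ₙ x * g ≡ n
  ↧*g≡n = ℤ.+-injective (trans (ℤ.pos-* (ℚ.↧ₙ x) g) (ℚ.↧-/ i n))

  instance
    g≢0 : NonZero g
    g≢0 = m*n≢0⇒n≢0 (ℚ.↧ₙ x) {{subst NonZero (sym ↧*g≡n) it}}

  r*g<n : r * g < n
  r*g<n = subst (r * g <_) ↧*g≡n (*-monoˡ-< g (ℤ.n%d<d (ℚ.↥ x) (ℚ.↧ x)))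

-- Small primes dividing the remainder and the quotient.

prime-divisor : ∀ n → .{{NonTrivial n}} → ∃[ s ] Prime s × s ∣ℕ n
prime-divisor n with factorise n {{nonTrivial⇒nonZero n}}
... | record { factors = [] ; isFactorisation = n≡1 } = contradiction n≡1 nonTrivial⇒≢1
... | record { factors = s ∷ ss ; isFactorisation = n≡s*ss ; factorsPrime = s-prime ∷ _ } =
  s , s-prime , subst (s ∣ℕ_) (sym n≡s*ss) (m∣m*n (product ss))

prime-divisor-< : ∀ {p r} → 2 < p → r < p → r ≢ 1 → ∃[ s ] Prime s × s < p × s ∣ℕ r
-- Every prime divides 0, so 2 serves when the remainder vanishes.
prime-divisor-< {r = 0} 2<p _ _ = 2 , prime[2] , 2<p , 2 ∣0
prime-divisor-< {r = 1} _ _ r≢1 = contradiction refl r≢1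
prime-divisor-< {r = r@(2+ _)} _ r<p _ with s , s-prime , s∣r ← prime-divisor r =
  s , s-prime , ≤-<-trans (∣⇒≤ s∣r) r<p , s∣r

n∣n! : ∀ n → .{{NonZero n}} → n ∣ℕ n !
n∣n! (suc n) = m∣m*n (n !)

-- Since `s` divides `a * m` and `r`, it divides their difference `Q * p`, and Euclid's lemma
-- applies.
∣-remainder⇒∣-quotient : ∀ {s a r} p Q m → Prime s → ¬ (s ∣ℕ p) → s ∣ℕ a → s ∣ℕ r →
                         + a ℤ.* m ≡ + r ℤ.+ Q ℤ.* + p → + s ∣ Q
∣-remainder⇒∣-quotient {s} {a} {r} p Q m s-prime s∤p s∣a s∣r eq
  with euclidsLemma ∣ Q ∣ p s-prime (subst (s ∣ℕ_) (ℤ.abs-* Q (+ p)) (Signed.∣⇒∣ᵤ s∣Qp))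
  where
  s∣Qp : + s Signed.∣ Q ℤ.* + p
  s∣Qp = Signed.∣m+n∣m⇒∣n
    (subst (+ s Signed.∣_) eq (Signed.∣m⇒∣m*n m (Signed.∣ᵤ⇒∣ {i = + a} s∣a)))
    (Signed.∣ᵤ⇒∣ {i = + r} s∣r)
... | inj₁ s∣Q = s∣Q
... | inj₂ s∣p = contradiction s∣p s∤p

-- With `a ≡ -1` modulo `p`, the equation reads `-(n² + c) ≡ 1`, so `n` itself is a square root of
-- `-c - 1`.
remainder-1⇒residue : ∀ {p a} Q c n → p ∣ℕ suc a →
                      + a ℤ.* (+ (n * n) ℤ.+ c) ≡ 1ℤ ℤ.+ Q ℤ.* + p →
                      QuadraticResidue p (- c - 1ℤ)
remainder-1⇒residue {p} {a} Q c n p∣1+a eq = + n , Signed.∣⇒∣ᵤ {i = + n ℤ.* + n - (- c - 1ℤ)}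
  (Signed.∣m+n∣n⇒∣m (subst (+ p Signed.∣_) (begin
      + suc a ℤ.* m                                     ≡⟨ expand (+ a) m ⟩
      + a ℤ.* m ℤ.+ m                                   ≡⟨ cong (ℤ._+ m) eq ⟩
      1ℤ ℤ.+ Q ℤ.* + p ℤ.+ m                            ≡⟨ cong (λ u → 1ℤ ℤ.+ Q ℤ.* + p ℤ.+ (u ℤ.+ c)) (ℤ.pos-* n n) ⟩
      1ℤ ℤ.+ Q ℤ.* + p ℤ.+ (+ n ℤ.* + n ℤ.+ c)          ≡⟨ regroup (Q ℤ.* + p) (+ n ℤ.* + n) c ⟩
      (+ n ℤ.* + n - (- c - 1ℤ)) ℤ.+ Q ℤ.* + p          ∎)
    (Signed.∣m⇒∣m*n m (Signed.∣ᵤ⇒∣ {i = + suc a} p∣1+a)))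
  (Signed.∣n⇒∣m*n Q Signed.∣-refl))
  where
  open ≡-Reasoning
  m = + (n * n) ℤ.+ c
  expand : ∀ a m → (1ℤ ℤ.+ a) ℤ.* m ≡ a ℤ.* m ℤ.+ m
  expand = ℤ.solve-∀
  regroup : ∀ u v c → 1ℤ ℤ.+ u ℤ.+ (v ℤ.+ c) ≡ (v - (- c - 1ℤ)) ℤ.+ u
  regroup = ℤ.solve-∀

-- Size estimates that keep the quotient from being a prime below `p`.

-- For `m ≠ 0` this is `a ≤ |a * m|` and the triangle inequality. For `m = 0` the remainder `r`
-- would equal `|Q| * p`, a positive multiple of `p`, against `r < p`.
quotient≢0⇒≤ : ∀ {p a r} Q m → r < p → Q ≢ 0ℤ →
               + a ℤ.* m ≡ + r ℤ.+ Q ℤ.* + p → a ≤ r + ∣ Q ∣ * p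
quotient≢0⇒≤ {p} {a} {r} Q m r<p Q≢0 eq with m ℤ.≟ 0ℤ
... | yes refl = contradiction (∣⇒≤ {{r≢0}} p∣r) (<⇒≱ r<p)
  where
  instance
    Q-nonZero : NonZero ∣ Q ∣
    Q-nonZero = ≢-nonZero (Q≢0 ∘ ℤ.∣i∣≡0⇒i≡0)
    p-nonZero : NonZero p
    p-nonZero = >-nonZero (≤-<-trans z≤n r<p)
  0≡r+Qp : 0ℤ ≡ + r ℤ.+ Q ℤ.* + p
  0≡r+Qp = trans (sym (ℤ.*-zeroʳ (+ a))) eq
  cancel : ∀ u v → v ≡ (u ℤ.+ v) - u
  cancel = ℤ.solve-∀
  ∣Q∣p≡r : ∣ Q ∣ * p ≡ r
  ∣Q∣p≡r = begin
    ∣ Q ∣ * p                       ≡⟨ ℤ.abs-* Q (+ p) ⟨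
    ∣ Q ℤ.* + p ∣                   ≡⟨ cong ∣_∣ (cancel (+ r) (Q ℤ.* + p)) ⟩
    ∣ (+ r ℤ.+ Q ℤ.* + p) - + r ∣   ≡⟨ cong (λ u → ∣ u - + r ∣) 0≡r+Qp ⟨
    ∣ 0ℤ - + r ∣                    ≡⟨ cong ∣_∣ (ℤ.+-identityˡ (- + r)) ⟩
    ∣ - + r ∣                       ≡⟨ ℤ.∣-i∣≡∣i∣ (+ r) ⟩
    r                               ∎
    where open ≡-Reasoning
  p∣r : p ∣ℕ r
  p∣r = divides ∣ Q ∣ (sym ∣Q∣p≡r)
  r≢0 : NonZero r
  r≢0 = subst NonZero ∣Q∣p≡r (m*n≢0 ∣ Q ∣ p)
... | no m≢0 = begin
  a                          ≤⟨ m≤m*n a ∣ m ∣ {{≢-nonZero (m≢0 ∘ ℤ.∣i∣≡0⇒i≡0)}} ⟩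
  a * ∣ m ∣                  ≡⟨ ℤ.abs-* (+ a) m ⟨
  ∣ + a ℤ.* m ∣              ≡⟨ cong ∣_∣ eq ⟩
  ∣ + r ℤ.+ Q ℤ.* + p ∣      ≤⟨ ℤ.∣i+j∣≤∣i∣+∣j∣ (+ r) (Q ℤ.* + p) ⟩
  r + ∣ Q ℤ.* + p ∣          ≡⟨ cong (r ℕ.+_) (ℤ.abs-* Q (+ p)) ⟩
  r + ∣ Q ∣ * p              ∎
  where open ≤-Reasoning

-- For `p = 5 + j` the left side is at most `(p - 1) + (p - 2) * p`, which is below
-- `2 * (p - 1) * (p - 2)`, and `(p - 3)!` is at least 2. Allowing `s = p - 1` would break
-- strictness at `p = 5`, where `4 + 4 * 5 = 4!`.
factorial-bound : ∀ j {r s} → r ≤ 4 + j → s ≤ 3 + j → r + s * (5 + j) < (4 + j) !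
factorial-bound j {r} {s} r≤ s≤ = begin-strict
  r + s * (5 + j)                    ≤⟨ +-mono-≤ r≤ (*-monoˡ-≤ (5 + j) s≤) ⟩
  -- The added term `5 + (j * j + 5 * j)` is exactly the gap up to `2 * (p - 1) * (p - 2)`.
  4 + j + (3 + j) * (5 + j)          <⟨ m<m+n _ z<s ⟩
  4 + j + (3 + j) * (5 + j) + (5 + (j * j + 5 * j)) ≡⟨ expand j ⟩
  (4 + j) * ((3 + j) * 2)            ≤⟨ *-monoʳ-≤ (4 + j) (*-monoʳ-≤ (3 + j) 2≤[2+j]!) ⟩
  (4 + j) !                          ∎
  where
  open ≤-Reasoning
  expand : ∀ j → 4 + j + (3 + j) * (5 + j) + (5 + (j * j + 5 * j)) ≡ (4 + j) * ((3 + j) * 2)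
  expand = solve-∀
  2≤[2+j]! : 2 ≤ (2 + j) !
  2≤[2+j]! = ≤-trans (m≤m+n 2 j) (m≤m*n (2 + j) (suc j !) {{suc j !≢0}})

2∣1+n⊎2∣n : ∀ n → 2 ∣ℕ suc n ⊎ 2 ∣ℕ n
2∣1+n⊎2∣n zero    = inj₂ (2 ∣0)
2∣1+n⊎2∣n (suc n) with 2∣1+n⊎2∣n n
... | inj₁ 2∣1+n = inj₂ 2∣1+n
... | inj₂ 2∣n   = inj₁ (∣m∣n⇒∣m+n ∣-refl 2∣n)

-- s = p ∸ 1 would be an even prime, hence 2.
prime<odd⇒≤ : ∀ j {s} → Prime s → ¬ (2 ∣ℕ 5 + j) → s < 5 + j → s ≤ 3 + j
prime<odd⇒≤ j s-prime 2∤p s<p with m≤n⇒m<n∨m≡n (s≤s⁻¹ s<p) | 2∣1+n⊎2∣n (4 + j)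
... | inj₁ s<4+j | _          = s≤s⁻¹ s<4+j
... | inj₂ refl  | inj₁ 2∣5+j = contradiction 2∣5+j 2∤p
... | inj₂ refl  | inj₂ 2∣4+j with prime⇒irreducible s-prime 2∣4+j
...   | inj₁ ()
...   | inj₂ ()

-- From 5 on, the two size estimates contradict each other, and 4 is even. At 3 the only smaller
-- prime is 2, and this exception does occur: `p = 3`, `c = 0`, `n = 2` gives the quotient 2.
prime-quotient⇒p≡3 : ∀ k Q m {r} → Prime ∣ Q ∣ → ∣ Q ∣ < 3 + k → ¬ (2 ∣ℕ 3 + k) → r < 3 + k →
  + ((2 + k) !) ℤ.* m ≡ + r ℤ.+ Q ℤ.* + (3 + k) → 3 + k ≡ 3 × ∣ Q ∣ ≡ 2
prime-quotient⇒p≡3 0 Q m Q-prime Q<3 _ _ _ =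
  refl , ≤-antisym (s≤s⁻¹ Q<3) (nonTrivial⇒n>1 ∣ Q ∣ {{prime⇒nonTrivial Q-prime}})
prime-quotient⇒p≡3 1 _ _ _ _ 2∤4 _ _ = contradiction (divides 2 refl) 2∤4
prime-quotient⇒p≡3 (2+ j) Q m Q-prime Q<p 2∤p r<p eq = contradiction
  (quotient≢0⇒≤ Q m r<p (λ { refl → ¬prime[0] Q-prime }) eq)
  (<⇒≱ (factorial-bound j (s≤s⁻¹ r<p) (prime<odd⇒≤ j Q-prime 2∤p Q<p)))

theorem12 : (p : ℕ) (p-prime : Prime p) → ¬ (2 ∣ℕ p) →
    (c : ℤ) → QuadraticNonresidue p (- c - 1ℤ) →
    (n : ℕ) → 1 ≤ n →
    let qₙ = q p {{prime⇒nonZero p-prime}} c n in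
    (∃[ r ] (Prime r × r < p × (+ r) ∣ qₙ))
    × (qₙ ≢ 0ℤ → ¬ (p ≡ 3 × ∣ qₙ ∣ ≡ 2) → Composite ∣ qₙ ∣)
theorem12 0 p-prime = contradiction p-prime ¬prime[0]
theorem12 1 p-prime = contradiction p-prime ¬prime[1]
theorem12 2 _ 2∤2 = contradiction ∣-refl 2∤2
theorem12 p@(suc (2+ k)) p-prime 2∤p c nonresidue n _
  with r , r<p , eq ← floor-/ (+ ((2 + k) !) ℤ.* (+ (n * n) ℤ.+ c)) p
  with s , s-prime , s<p , s∣r ← prime-divisor-< (s≤s (s≤s (s≤s z≤n))) r<p
         (λ { refl → nonresidue (remainder-1⇒residue (q p c n) c n (wilson k p-prime) eq) })
  = (s , s-prime , s<p , s∣Q) , composite-Q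
  where
  Q = q p c n
  m = + (n * n) ℤ.+ c
  instance
    _ = prime⇒nonZero s-prime
    _ = prime⇒nonTrivial s-prime

  s∤p : ¬ (s ∣ℕ p)
  s∤p s∣p = prime⇒¬composite p-prime (composite s<p s∣p)

  s∣Q : + s ∣ Q
  s∣Q = ∣-remainder⇒∣-quotient p Q m s-prime s∤p
    -- From `s ≤ p - 1`, `s` divides `s!`, which divides `(p - 1)!`.
    (∣-trans (n∣n! s) (m≤n⇒m!∣n! (s≤s⁻¹ s<p))) s∣r eq

  composite-Q : Q ≢ 0ℤ → ¬ (p ≡ 3 × ∣ Q ∣ ≡ 2) → Composite ∣ Q ∣
  -- The divisor `s` is proper: if it equalled `|Q|`, then `|Q|` would be a prime below `p`, which
  -- leaves only the excluded case.
  composite-Q Q≢0 ¬exception = composite-≢ s {{it}} {{≢-nonZero (Q≢0 ∘ ℤ.∣i∣≡0⇒i≡0)}}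
    (λ s≡∣Q∣ → ¬exception (prime-quotient⇒p≡3 k Q m
      (subst Prime s≡∣Q∣ s-prime) (subst (_< p) s≡∣Q∣ s<p) 2∤p r<p eq))
    s∣Q
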